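{- For every $n>0$, the core label order $\mathrm{CLO}(\mathrm{Hoch}(n))$ of the Hochschild lattice $\mathrm{Hoch}(n)$ is a lattice.
   Context: Hochschild lattice. For $n\geq 1$, a triword of length $n$ is a tuple $u=(u_1,\ldots,u_n)$ such that (T1) $u_i\in\{0,1,2\}$ for all $i$; (T2) $u_1\neq 2$; (T3) if $u_i=0$, then $u_j\neq 1$ for all $j>i$. Let $\mathrm{Tri}(n)$ be the set of all triwords of length $n$. The Hochschild lattice is $\mathrm{Hoch}(n)=(\mathrm{Tri}(n),\leq)$ where $\leq$ is the componentwise order. It is known to be a semidistributive lattice: the join is the componentwise maximum, and the meet is obtained by taking the componentwise minimum and then replacing by $0$ every entry $1$ that has an entry $0$ somewhere to its left. Core label order. Let $L$ be a finite semidistributive lattice. For a cover relation $a\lessdot b$ put $\lambda(a,b)=\min\{c\in L\mid a\vee c=b\}$; this minimum exists and is join irreducible. The nucleus of $a\in L$ is $a_\downarrow=a\wedge\bigwedge_{b\lessdot a}b$. The core label set of $a$ is $\Psi(a)=\{\lambda(b,b')\mid a_\downarrow\leq b\lessdot b'\leq a\}$. The map $a\mapsto\Psi(a)$ is injective. The core label order $\mathrm{CLO}(L)$ is the poset $(L,\sqsubseteq)$ where $a\sqsubseteq b$ if and only if $\Psi(a)\subseteq\Psi(b)$. -}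

module Defs where

open import Data.Empty using (⊥-elim-irr)
open import Data.Fin.Base using (Fin; toℕ; _≤_; _<_)
open import Data.Fin.Patterns using (0F; 1F; 2F)
import Data.Fin.Properties as Finₚ
open import Data.Nat.Base using (ℕ; z≤n; s≤s)
open import Data.Product.Base using (_×_; _,_; ∃₂; ∃-syntax)
open import Data.Sum.Base using (inj₁; inj₂)
open import Data.Vec.Base using (Vec; []; _∷_; lookup; map; zipWith)
open import Data.Vec.Properties using (lookup-zipWith; lookup-map)
open import Data.Vec.Relation.Binary.Pointwise.Inductive as Pointwise
  using (Pointwise; []; _∷_)
open import Level using (_⊔_)
open import Relation.Binary.Core using (Rel)
import Relation.Binary.Construct.NonStrictToStrict as ToStrict
open import Relation.Binary.Lattice.Bundles using (Lattice)
open import Relation.Binary.Lattice.Structures using (IsLattice)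
open import Relation.Binary.PropositionalEquality
  using (_≡_; _≢_; refl; sym; trans; subst; isEquivalence)
open import Relation.Nullary.Negation.Core using (¬_)
open import Relation.Unary using (Pred; _⊆_)
import Algebra.Construct.NaturalChoice.Max as NCMax
import Algebra.Construct.NaturalChoice.Min as NCMin

IsLatticeOrder : ∀ {a ℓ₁ ℓ₂} {A : Set a} → Rel A ℓ₁ → Rel A ℓ₂ → Set (a ⊔ ℓ₁ ⊔ ℓ₂)
IsLatticeOrder _≈_ _≤_ = ∃₂ λ _∨_ _∧_ → IsLattice _≈_ _≤_ _∨_ _∧_

-- The label λ(a,b) and the nucleus of a are given by their defining universal
-- properties: in a finite semidistributive lattice each exists, and in any
-- lattice each is unique up to ≈.

module CoreLabel {c ℓ₁ ℓ₂} (L : Lattice c ℓ₁ ℓ₂) where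

  private module L = Lattice L
  open L using (Carrier; _≈_; _∨_)

  open ToStrict _≈_ L._≤_ using () renaming (_<_ to _≺_)

  infix 4 _⋖_ _⊑_

  _⋖_ : Rel Carrier (c ⊔ ℓ₁ ⊔ ℓ₂)
  a ⋖ b = a ≺ b × (∀ x → ¬ (a ≺ x × x ≺ b))

  -- l = min { x ∣ a ∨ x = b }
  IsLabel : (a b l : Carrier) → Set (c ⊔ ℓ₁ ⊔ ℓ₂)
  IsLabel a b l = a ∨ l ≈ b × (∀ x → a ∨ x ≈ b → l L.≤ x)

  -- ν is the greatest lower bound of { a } ∪ { b ∣ b ⋖ a }
  IsNucleus : (a ν : Carrier) → Set (c ⊔ ℓ₁ ⊔ ℓ₂)
  IsNucleus a ν = IsLowerBound ν × (∀ x → IsLowerBound x → x L.≤ ν)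
    where
    IsLowerBound : Carrier → Set (c ⊔ ℓ₁ ⊔ ℓ₂)
    IsLowerBound x = x L.≤ a × (∀ b → b ⋖ a → x L.≤ b)

  Ψ : Carrier → Pred Carrier (c ⊔ ℓ₁ ⊔ ℓ₂)
  Ψ a l = ∃[ ν ] ∃[ b ] ∃[ b′ ]
    IsNucleus a ν × ν L.≤ b × b ⋖ b′ × b′ L.≤ a × IsLabel b b′ l

  _⊑_ : Rel Carrier (c ⊔ ℓ₁ ⊔ ℓ₂)
  a ⊑ b = Ψ a ⊆ Ψ b

Word : ℕ → Set
Word = Vec (Fin 3)

T2 : ∀ {n} → Word n → Set
T2 w = ∀ i → toℕ i ≡ 0 → lookup w i ≢ 2F

T3 : ∀ {n} → Word n → Set
T3 w = ∀ {i j} → i < j → lookup w i ≡ 0F → lookup w j ≢ 1F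

-- The conditions are irrelevant fields, so that triwords are propositionally
-- equal exactly when their underlying words are.
record Triword (n : ℕ) : Set where
  constructor triword
  field
    word : Word n
    .t2  : T2 word
    .t3  : T3 word

open Triword public using (word)

private
  variable
    n : ℕ

open NCMax (Finₚ.≤-totalOrder 3)
  using (⊔-sel; x≤x⊔y; ⊔-lub) renaming (_⊔_ to max; x≤y⊔x to y≤x⊔y)
open NCMin (Finₚ.≤-totalOrder 3)
  using (x⊓y≤x; x⊓y≤y; ⊓-glb) renaming (_⊓_ to min)

infix 4 _≼_ _≤ᵗ_

_≼_ : Rel (Word n) _
_≼_ = Pointwise _≤_

_≤ᵗ_ : Rel (Triword n) _
u ≤ᵗ v = word u ≼ word v

maxʷ : Word n → Word n → Word n
maxʷ = zipWith max

minʷ : Word n → Word n → Word n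
minʷ = zipWith min

drop1 : Fin 3 → Fin 3
drop1 0F = 0F
drop1 1F = 0F
drop1 2F = 2F

-- Replaces by 0 every entry 1 that has an entry 0 somewhere to its left.
normalise : Word n → Word n
normalise []       = []
normalise (0F ∷ w) = 0F ∷ map drop1 w
normalise (1F ∷ w) = 1F ∷ normalise w
normalise (2F ∷ w) = 2F ∷ normalise w

≡0 : {x : Fin 3} → _≤_ {3} {3} x 0F → x ≡ 0F
≡0 {0F} _ = refl

≡2 : {x : Fin 3} → _≤_ {3} {3} 2F x → x ≡ 2F
≡2 {2F} _ = refl
≡2 {1F} (s≤s ())

maxʷ-T2 : (u v : Word n) → T2 u → T2 v → T2 (maxʷ u v)
maxʷ-T2 u v pu pv i i≡0 eq
  with ⊔-sel (lookup u i) (lookup v i) | trans (sym (lookup-zipWith max i u v)) eq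
... | inj₁ s | e = pu i i≡0 (trans (sym s) e)
... | inj₂ s | e = pv i i≡0 (trans (sym s) e)

maxʷ-T3 : (u v : Word n) → T3 u → T3 v → T3 (maxʷ u v)
maxʷ-T3 u v pu pv {i} {j} i<j eq0 eq1
  with ⊔-sel (lookup u j) (lookup v j) | trans (sym (lookup-zipWith max j u v)) eq1
     | trans (sym (lookup-zipWith max i u v)) eq0
... | inj₁ s | e | e0 = pu i<j
  (≡0 (subst (lookup u i ≤_) e0 (x≤x⊔y (lookup u i) (lookup v i)))) (trans (sym s) e)
... | inj₂ s | e | e0 = pv i<j
  (≡0 (subst (lookup v i ≤_) e0 (y≤x⊔y (lookup u i) (lookup v i)))) (trans (sym s) e)

drop1-≤ : (x : Fin 3) → drop1 x ≤ x
drop1-≤ 0F = z≤n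
drop1-≤ 1F = z≤n
drop1-≤ 2F = s≤s (s≤s z≤n)

drop1-≢1 : (x : Fin 3) → drop1 x ≢ 1F
drop1-≢1 0F ()
drop1-≢1 1F ()
drop1-≢1 2F ()

drop1-greatest : {x y : Fin 3} → x ≢ 1F → x ≤ y → x ≤ drop1 y
drop1-greatest {0F}      x≢1 x≤y = z≤n
drop1-greatest {1F}      x≢1 x≤y with () ← x≢1 refl
drop1-greatest {2F} {1F} x≢1 (s≤s ())
drop1-greatest {2F} {2F} x≢1 x≤y = x≤y

map-drop1-≼ : (w : Word n) → map drop1 w ≼ w
map-drop1-≼ []      = []
map-drop1-≼ (x ∷ w) = drop1-≤ x ∷ map-drop1-≼ w

map-drop1-greatest : {v w : Word n} → (∀ i → lookup v i ≢ 1F) → v ≼ w → v ≼ map drop1 w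
map-drop1-greatest h []      = []
map-drop1-greatest h (p ∷ q) = drop1-greatest (h 0F) p ∷ map-drop1-greatest (λ i → h (Fin.suc i)) q

normalise-≼ : (w : Word n) → normalise w ≼ w
normalise-≼ []       = []
normalise-≼ (0F ∷ w) = z≤n ∷ map-drop1-≼ w
normalise-≼ (1F ∷ w) = s≤s z≤n ∷ normalise-≼ w
normalise-≼ (2F ∷ w) = s≤s (s≤s z≤n) ∷ normalise-≼ w

normalise-T3 : (w : Word n) → T3 (normalise w)
normalise-T3 (0F ∷ w) {_}         {Fin.suc j} i<j       e0 e1 =
  drop1-≢1 (lookup w j) (trans (sym (lookup-map j drop1 w)) e1)
normalise-T3 (1F ∷ w) {Fin.suc i} {Fin.suc j} (s≤s i<j) e0 e1 = normalise-T3 w i<j e0 e1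
normalise-T3 (2F ∷ w) {Fin.suc i} {Fin.suc j} (s≤s i<j) e0 e1 = normalise-T3 w i<j e0 e1

T3-tail : {x : Fin 3} {v : Word n} → T3 (x ∷ v) → T3 v
T3-tail p i<j = p (s≤s i<j)

normalise-greatest : {v w : Word n} → T3 v → v ≼ w → v ≼ normalise w
normalise-greatest t []                     = []
normalise-greatest {w = 0F ∷ _} t (p ∷ q) =
  p ∷ map-drop1-greatest (λ i → t {0F} {Fin.suc i} (s≤s z≤n) (≡0 p)) q
normalise-greatest {w = 1F ∷ _} t (p ∷ q) = p ∷ normalise-greatest (T3-tail t) q
normalise-greatest {w = 2F ∷ _} t (p ∷ q) = p ∷ normalise-greatest (T3-tail t) q

T2-down : {v w : Word n} → v ≼ w → T2 w → T2 v
T2-down v≼w t i i≡0 e = t i i≡0 (≡2 (subst (_≤ _) e (Pointwise.lookup v≼w i)))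

≼-refl : {v : Word n} → v ≼ v
≼-refl = Pointwise.refl Finₚ.≤-refl

≼-trans : {u v w : Word n} → u ≼ v → v ≼ w → u ≼ w
≼-trans = Pointwise.trans Finₚ.≤-trans

≼-antisym : {u v : Word n} → u ≼ v → v ≼ u → u ≡ v
≼-antisym []      []        = refl
≼-antisym (p ∷ q) (p′ ∷ q′) with refl ← Finₚ.≤-antisym p p′ | refl ← ≼-antisym q q′ = refl

maxʷ-ub₁ : (u v : Word n) → u ≼ maxʷ u v
maxʷ-ub₁ []      []      = []
maxʷ-ub₁ (x ∷ u) (y ∷ v) = x≤x⊔y x y ∷ maxʷ-ub₁ u v

maxʷ-ub₂ : (u v : Word n) → v ≼ maxʷ u v
maxʷ-ub₂ []      []      = []
maxʷ-ub₂ (x ∷ u) (y ∷ v) = y≤x⊔y x y ∷ maxʷ-ub₂ u v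

maxʷ-lub : {u v w : Word n} → u ≼ w → v ≼ w → maxʷ u v ≼ w
maxʷ-lub []      []        = []
maxʷ-lub (p ∷ q) (p′ ∷ q′) = ⊔-lub p p′ ∷ maxʷ-lub q q′

minʷ-lb₁ : (u v : Word n) → minʷ u v ≼ u
minʷ-lb₁ []      []      = []
minʷ-lb₁ (x ∷ u) (y ∷ v) = x⊓y≤x x y ∷ minʷ-lb₁ u v

minʷ-lb₂ : (u v : Word n) → minʷ u v ≼ v
minʷ-lb₂ []      []      = []
minʷ-lb₂ (x ∷ u) (y ∷ v) = x⊓y≤y x y ∷ minʷ-lb₂ u v

minʷ-glb : {u v w : Word n} → w ≼ u → w ≼ v → w ≼ minʷ u v
minʷ-glb []      []        = []
minʷ-glb (p ∷ q) (p′ ∷ q′) = ⊓-glb p p′ ∷ minʷ-glb q q′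

-- A negation can be recovered from an irrelevant proof of it.
T3-recover : (u : Triword n) → T3 (word u)
T3-recover (triword _ _ t) i<j e0 e1 = ⊥-elim-irr (t i<j e0 e1)

word-injective : {u v : Triword n} → word u ≡ word v → u ≡ v
word-injective refl = refl

_∨ᵗ_ : Triword n → Triword n → Triword n
triword u u2 u3 ∨ᵗ triword v v2 v3 =
  triword (maxʷ u v) (maxʷ-T2 u v u2 v2) (maxʷ-T3 u v u3 v3)

_∧ᵗ_ : Triword n → Triword n → Triword n
triword u u2 u3 ∧ᵗ triword v v2 v3 =
  triword (normalise (minʷ u v))
          (T2-down (≼-trans (normalise-≼ (minʷ u v)) (minʷ-lb₁ u v)) u2)
          (normalise-T3 (minʷ u v))

Hoch : ℕ → Lattice _ _ _
Hoch n = record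
  { Carrier   = Triword n
  ; _≈_       = _≡_
  ; _≤_       = _≤ᵗ_
  ; _∨_       = _∨ᵗ_
  ; _∧_       = _∧ᵗ_
  ; isLattice = record
    { isPartialOrder = record
      { isPreorder = record
        { isEquivalence = isEquivalence
        ; reflexive     = λ { refl → ≼-refl }
        ; trans         = ≼-trans
        }
      ; antisym = λ p q → word-injective (≼-antisym p q)
      }
    ; supremum = λ u v →
        maxʷ-ub₁ (word u) (word v) , maxʷ-ub₂ (word u) (word v) , λ _ → maxʷ-lub
    ; infimum = λ u v →
        ≼-trans (normalise-≼ _) (minʷ-lb₁ (word u) (word v)) ,
        ≼-trans (normalise-≼ _) (minʷ-lb₂ (word u) (word v)) ,
        λ w p q → normalise-greatest (T3-recover w) (minʷ-glb p q)
    }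
  }

{-# OPTIONS --safe #-}

-- The join irreducibles of Hoch(n) are α j = 1…10…0 (last 1 at j) and β i (a single 2
-- at i).  The set Ψ(u) consists of the β i with uᵢ = 2 and the α j with j in the block
-- of u: the last 1 of u together with the run of 2s directly after it (empty if u has
-- no 1).  So ⊑ is inclusion of the sets of twos together with inclusion of the blocks.
-- Intersecting both sets again gives the data of a triword, which is the meet.  For the
-- join, the union of the sets of twos is enlarged by the positions between two elements
-- of the blocks, and the block is the one that contains the union of the blocks.

module Submission where

open import Data.Empty using (⊥; ⊥-elim; ⊥-elim-irr)
open import Data.Fin.Base using (Fin; zero; suc; toℕ; _≤_; _<_)
open import Data.Fin.Patterns using (0F; 1F; 2F)
import Data.Fin.Properties as Finₚ
open import Data.Nat.Base using (ℕ; suc; _>_; z≤n; s≤s)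
import Data.Nat.Properties as ℕₚ
open import Data.Product.Base using (_×_; _,_; proj₁; proj₂; ∃; ∃-syntax)
open import Data.Sum.Base using (_⊎_; inj₁; inj₂)
open import Data.Vec.Base using ([]; _∷_; lookup; tabulate)
open import Data.Vec.Properties using (≡-dec; lookup∘tabulate; lookup-zipWith)
open import Data.Vec.Relation.Binary.Pointwise.Inductive as Pointwise using ([]; _∷_)
open import Function.Base using (_∘_; case_of_)
open import Level using (0ℓ)
open import Relation.Binary.Definitions using (DecidableEquality)
open import Relation.Binary.PropositionalEquality
  using (_≡_; _≢_; refl; sym; trans; cong; subst; isEquivalence)
open import Relation.Nullary.Decidable.Core using (Dec; yes; no; map′; ¬?; _×-dec_; _⊎-dec_; _→-dec_)
open import Relation.Nullary.Negation.Core using (¬_; contradiction)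
open import Relation.Unary using (Pred; Decidable)
import Algebra.Construct.NaturalChoice.Max as NCMax
open import Defs

open NCMax (Finₚ.≤-totalOrder 3) using (⊔-sel)

private
  module Core {n : ℕ} = CoreLabel (Hoch n)
  variable
    n : ℕ
    i j k : Fin n
    x y : Fin 3
    A B : Set
    T M : Pred (Fin n) 0ℓ

open Core

-- Entries of triwords

infix 8 _!_

_!_ : Triword n → Fin n → Fin 3
u ! i = lookup (word u) i

≤-letter : (x ≢ 0F → y ≢ 0F) → (x ≡ 2F → y ≡ 2F) → x ≤ y
≤-letter {0F} h g = z≤n
≤-letter {1F} {0F} h g = contradiction refl (h λ ())
≤-letter {1F} {1F} h g = s≤s z≤n
≤-letter {1F} {2F} h g = s≤s z≤n
≤-letter {2F} h g with refl ← g refl = ℕₚ.≤-refl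

nonzero-mono : x ≤ y → x ≢ 0F → y ≢ 0F
nonzero-mono x≤y x≢0 refl = x≢0 (≡0 x≤y)

two-mono : x ≤ y → x ≡ 2F → y ≡ 2F
two-mono x≤y refl = ≡2 x≤y

letter-one : x ≢ 0F → x ≢ 2F → x ≡ 1F
letter-one {0F} p q = contradiction refl p
letter-one {1F} p q = refl
letter-one {2F} p q = contradiction refl q

letter-two : x ≢ 0F → x ≢ 1F → x ≡ 2F
letter-two {0F} p q = contradiction refl p
letter-two {1F} p q = contradiction refl q
letter-two {2F} p q = refl

letter-zero : x ≢ 1F → x ≢ 2F → x ≡ 0F
letter-zero {0F} p q = refl
letter-zero {1F} p q = contradiction refl p
letter-zero {2F} p q = contradiction refl q

≼-ext : ∀ {n} {v w : Word n} → (∀ i → lookup v i ≤ lookup w i) → v ≼ w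
≼-ext {v = []}    {[]}    h = []
≼-ext {v = _ ∷ _} {_ ∷ _} h = h zero ∷ ≼-ext (h ∘ suc)

≤ᵗ-antisym : (u v : Triword n) → u ≤ᵗ v → v ≤ᵗ u → u ≡ v
≤ᵗ-antisym _ _ p q = word-injective (≼-antisym p q)

_≟ᵗ_ : DecidableEquality (Triword n)
u ≟ᵗ v = map′ word-injective (cong word) (≡-dec Finₚ._≟_ (word u) (word v))

∨-sel : ∀ (u v : Triword n) i → (u ∨ᵗ v) ! i ≡ u ! i ⊎ (u ∨ᵗ v) ! i ≡ v ! i
∨-sel u v i rewrite lookup-zipWith (NCMax._⊔_ (Finₚ.≤-totalOrder 3)) i (word u) (word v) =
  ⊔-sel (u ! i) (v ! i)

first≢2 : (u : Triword n) → u ! i ≡ 2F → toℕ i ≢ 0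
first≢2 (triword _ t _) e i≡0 = ⊥-elim-irr (t _ i≡0 e)

nonzero-before-1 : (u : Triword n) → i ≤ j → u ! j ≡ 1F → u ! i ≢ 0F
nonzero-before-1 {i = i} {j} u i≤j e e0 with i Finₚ.≟ j
... | yes refl with () ← trans (sym e0) e
... | no  i≢j  = T3-recover u (Finₚ.≤∧≢⇒< i≤j i≢j) e0 e

-- T2 excludes a 2 in the first position, so a nonzero first entry is a 1.
has-one : ∀ {n} (u : Triword n) {k : Fin n} → (∀ i → i ≤ k → u ! i ≢ 0F) → ∃[ i ] u ! i ≡ 1F
has-one {suc _} u nonzero = zero , letter-one (nonzero zero z≤n) λ e → first≢2 u e refl

-- Triwords with a prescribed set of twos

data Letter (A B : Set) : Fin 3 → Set where
  two  : A → Letter A B 2F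
  one  : ¬ A → B → Letter A B 1F
  none : ¬ A → ¬ B → Letter A B 0F

letter : Dec A → Dec B → ∃ (Letter A B)
letter (yes a) _       = 2F , two a
letter (no ¬a) (yes b) = 1F , one ¬a b
letter (no ¬a) (no ¬b) = 0F , none ¬a ¬b

letter≡2⁻ : Letter A B x → x ≡ 2F → A
letter≡2⁻ (two a) _ = a

letter≡2⁺ : Letter A B x → A → x ≡ 2F
letter≡2⁺ (two _)     _ = refl
letter≡2⁺ (one ¬a _)  a = contradiction a ¬a
letter≡2⁺ (none ¬a _) a = contradiction a ¬a

letter≡1⁻ : Letter A B x → x ≡ 1F → ¬ A × B
letter≡1⁻ (one ¬a b) _ = ¬a , b

letter≢0⁻ : Letter A B x → x ≢ 0F → A ⊎ B
letter≢0⁻ (two a)    _   = inj₁ a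
letter≢0⁻ (one _ b)  _   = inj₂ b
letter≢0⁻ (none _ _) x≢0 = contradiction refl x≢0

letter≢0⁺ : Letter A B x → A ⊎ B → x ≢ 0F
letter≢0⁺ (none ¬a _) (inj₁ a) _ = ¬a a
letter≢0⁺ (none _ ¬b) (inj₂ b) _ = ¬b b

letter-elim : Letter A B x → (A → y ≡ 2F) → (¬ A → B → y ≡ 1F) → (¬ A → ¬ B → y ≡ 0F) → x ≡ y
letter-elim (two a)      f g h = sym (f a)
letter-elim (one ¬a b)   f g h = sym (g ¬a b)
letter-elim (none ¬a ¬b) f g h = sym (h ¬a ¬b)

DownClosed : Pred (Fin n) 0ℓ → Set
DownClosed D = ∀ {i j} → i ≤ j → D j → D i

-- Entries are 2 on `T`, 1 on the rest of `D` and 0 elsewhere. `first` yields T2, and `down` yields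
-- T3 because every position before a 1 lies in `D`.
record Spec (T D : Pred (Fin n) 0ℓ) : Set where
  field
    T?    : Decidable T
    D?    : Decidable D
    first : ∀ {i} → T i → toℕ i ≢ 0
    down  : DownClosed D

  letters : Word n
  letters = tabulate λ i → proj₁ (letter (T? i) (D? i))

  letters-lookup : ∀ i → Letter (T i) (D i) (lookup letters i)
  letters-lookup i =
    subst (Letter (T i) (D i)) (sym (lookup∘tabulate _ i)) (proj₂ (letter (T? i) (D? i)))

  build : Triword n
  build = triword letters
    (λ i i≡0 e → first (letter≡2⁻ (letters-lookup i) e) i≡0)
    (λ {i} {j} i<j e0 e1 → letter≢0⁺ (letters-lookup i)
      (inj₂ (down (ℕₚ.<⇒≤ i<j) (proj₂ (letter≡1⁻ (letters-lookup j) e1)))) e0)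

  letter-at : ∀ i → Letter (T i) (D i) (build ! i)
  letter-at = letters-lookup

open Spec using (build; letter-at)

-- Join irreducibles

α-spec : (j : Fin n) → Spec (λ _ → ⊥) (_≤ j)
α-spec j = record
  { T? = λ _ → no λ ()
  ; D? = Finₚ._≤? j
  ; first = λ ()
  ; down = Finₚ.≤-trans
  }

α : Fin n → Triword n
α j = build (α-spec j)

-- With the second condition on i, β 0F is the bottom element.
β-spec : (i : Fin n) → Spec (λ k → k ≡ i × toℕ k ≢ 0) (λ _ → ⊥)
β-spec i = record
  { T? = λ k → k Finₚ.≟ i ×-dec ¬? (toℕ k ℕₚ.≟ 0)
  ; D? = λ _ → no λ ()
  ; first = proj₂
  ; down = λ _ ()
  }

β : Fin n → Triword n
β i = build (β-spec i)

α-at-self : (j : Fin n) → α j ! j ≢ 0F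
α-at-self j = letter≢0⁺ (letter-at (α-spec j) j) (inj₂ Finₚ.≤-refl)

α≢2 : (j k : Fin n) → α j ! k ≢ 2F
α≢2 j k e = letter≡2⁻ (letter-at (α-spec j) k) e

α≢0⁻ : (j k : Fin n) → α j ! k ≢ 0F → k ≤ j
α≢0⁻ j k p with letter≢0⁻ (letter-at (α-spec j) k) p
... | inj₂ k≤j = k≤j

β-at-self : toℕ i ≢ 0 → β i ! i ≡ 2F
β-at-self {i = i} p = letter≡2⁺ (letter-at (β-spec i) i) (refl , p)

β≡2⁻ : (i k : Fin n) → β i ! k ≡ 2F → k ≡ i
β≡2⁻ i k e = proj₁ (letter≡2⁻ (letter-at (β-spec i) k) e)

β≢0⁻ : (i k : Fin n) → β i ! k ≢ 0F → k ≡ i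
β≢0⁻ i k p with letter≢0⁻ (letter-at (β-spec i) k) p
... | inj₁ (e , _) = e

α≤ : (u : Triword n) → (∀ k → k ≤ j → u ! k ≢ 0F) → α j ≤ᵗ u
α≤ {j = j} u h = ≼-ext λ k →
  ≤-letter (λ p → h k (α≢0⁻ j k p)) (λ e → contradiction e (α≢2 j k))

β≤ : (u : Triword n) → u ! i ≡ 2F → β i ≤ᵗ u
β≤ {i = i} u e = ≼-ext λ k → ≤-letter
  (λ p → subst (λ k → u ! k ≢ 0F) (sym (β≢0⁻ i k p)) (λ e0 → case trans (sym e0) e of λ ()))
  (λ p → subst (λ k → u ! k ≡ 2F) (sym (β≡2⁻ i k p)) e)

-- Covers

∨-ub₁ : (u v : Triword n) → u ≤ᵗ u ∨ᵗ v
∨-ub₁ u v = maxʷ-ub₁ (word u) (word v)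

∨-ub₂ : (u v : Triword n) → v ≤ᵗ u ∨ᵗ v
∨-ub₂ u v = maxʷ-ub₂ (word u) (word v)

-- The join lies weakly between `c` and `u` and differs from `c`, so the cover leaves only `u`.
⋖-join : (c u l : Triword n) → c ⋖ u → l ≤ᵗ u → ¬ l ≤ᵗ c → c ∨ᵗ l ≡ u
⋖-join c u l ((c≤u , _) , gap) l≤u l≰c with (c ∨ᵗ l) ≟ᵗ u
... | yes e = e
... | no ≢u = contradiction
  ( (∨-ub₁ c l , λ e → l≰c (subst (l ≤ᵗ_) {y = c} (sym e) (∨-ub₂ c l)))
  , (maxʷ-lub c≤u l≤u , ≢u))
  (gap (c ∨ᵗ l))

-- An element between `c` and `u` agrees with both away from `i`, so its entry at `i` decides which
-- of the two it equals.
⋖-single : (c u : Triword n) → ∀ i → c ! i ≢ u ! i → c ! i ≤ u ! i →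
           (∀ k → k ≢ i → c ! k ≡ u ! k) →
           (∀ x → c ≤ᵗ x → x ≤ᵗ u → x ! i ≡ c ! i ⊎ x ! i ≡ u ! i) → c ⋖ u
⋖-single c u i ≢i ≤i agree gap = (c≤u , λ e → ≢i (cong (_! i) e)) ,
  λ x ((c≤x , c≢x) , (x≤u , x≢u)) → case gap x c≤x x≤u of λ where
    (inj₁ e) → c≢x (≤ᵗ-antisym c x c≤x (≼-ext λ k → case k Finₚ.≟ i of λ where
      (yes refl) → Finₚ.≤-reflexive e
      (no k≢i)   → subst (x ! k ≤_) (sym (agree k k≢i)) (Pointwise.lookup x≤u k)))
    (inj₂ e) → x≢u (≤ᵗ-antisym x u x≤u (≼-ext λ k → case k Finₚ.≟ i of λ where
      (yes refl) → Finₚ.≤-reflexive (sym e)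
      (no k≢i)   → subst (_≤ x ! k) (agree k k≢i) (Pointwise.lookup c≤x k)))
  where
  c≤u : c ≤ᵗ u
  c≤u = ≼-ext λ k → case k Finₚ.≟ i of λ where
    (yes refl) → ≤i
    (no k≢i)   → Finₚ.≤-reflexive (agree k k≢i)

dropTwo-spec : (u : Triword n) (i : Fin n) →
  Spec (λ k → u ! k ≡ 2F × k ≢ i) (λ k → ∀ j → j ≤ k → u ! j ≢ 0F)
dropTwo-spec u i = record
  { T?    = λ k → u ! k Finₚ.≟ 2F ×-dec ¬? (k Finₚ.≟ i)
  ; D?    = λ k → Finₚ.all? λ j → j Finₚ.≤? k →-dec ¬? (u ! j Finₚ.≟ 0F)
  ; first = λ (e , _) → first≢2 u e
  ; down  = λ p h j q → h j (Finₚ.≤-trans q p)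
  }

-- The entry 2 at i becomes 1 if no 0 precedes it, and 0 otherwise.
dropTwo : Triword n → Fin n → Triword n
dropTwo u i = build (dropTwo-spec u i)

dropTwo≢2 : (u : Triword n) (i : Fin n) → dropTwo u i ! i ≢ 2F
dropTwo≢2 u i e = proj₂ (letter≡2⁻ (letter-at (dropTwo-spec u i) i) e) refl

dropTwo-⋖ : (u : Triword n) → u ! i ≡ 2F → dropTwo u i ⋖ u
dropTwo-⋖ {i = i} u ui≡2 = ⋖-single c u i
  (λ e → dropTwo≢2 u i (trans e ui≡2))
  (subst (c ! i ≤_) (sym ui≡2) (Finₚ.≤fromℕ (c ! i)))
  (λ k k≢i → letter-elim (letter-at (dropTwo-spec u i) k)
    proj₁
    (λ ¬a b → letter-one (b k Finₚ.≤-refl) (λ e → ¬a (e , k≢i)))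
    (λ ¬a ¬b → letter-zero (λ e → ¬b λ j j≤k → nonzero-before-1 u j≤k e) (λ e → ¬a (e , k≢i))))
  gap
  where
  c = dropTwo u i
  gap : ∀ x → c ≤ᵗ x → x ≤ᵗ u → x ! i ≡ c ! i ⊎ x ! i ≡ u ! i
  gap x c≤x x≤u with x ! i in e | Pointwise.lookup c≤x i
  ... | 0F | c≤0 = inj₁ (sym (≡0 c≤0))
  -- A 1 of `x` at `i` forbids earlier zeros in `x`, hence in `u`, and then `dropTwo u i` has a 1
  -- there too.
  ... | 1F | _   = inj₁ (sym (letter-one
    (letter≢0⁺ (letter-at (dropTwo-spec u i) i)
      (inj₂ λ j j≤i → nonzero-mono (Pointwise.lookup x≤u j) (nonzero-before-1 x j≤i e)))
    (dropTwo≢2 u i)))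
  ... | 2F | _   = inj₂ (sym ui≡2)

IsLastOne : Triword n → Fin n → Set
IsLastOne u i = u ! i ≡ 1F × (∀ k → i < k → u ! k ≢ 1F)

-- If `i` is the last 1 of `u`, the entries of `u` other than 2 are 1 up to `i` and 0 afterwards, so
-- the strict bound `_< i` changes the entry at `i` only.
dropOne-spec : (u : Triword n) (i : Fin n) → Spec (λ k → u ! k ≡ 2F) (_< i)
dropOne-spec u i = record
  { T?    = λ k → u ! k Finₚ.≟ 2F
  ; D?    = Finₚ._<? i
  ; first = first≢2 u
  ; down  = ℕₚ.≤-<-trans
  }

dropOne : Triword n → Fin n → Triword n
dropOne u i = build (dropOne-spec u i)

dropOne≡0 : (u : Triword n) → u ! i ≡ 1F → dropOne u i ! i ≡ 0F
dropOne≡0 {i = i} u e = letter-elim (letter-at (dropOne-spec u i) i)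
  (λ e2 → case trans (sym e) e2 of λ ())
  (λ _ i<i → contradiction i<i (Finₚ.<-irrefl refl))
  (λ _ _ → refl)

dropOne-⋖ : (u : Triword n) → IsLastOne u i → dropOne u i ⋖ u
dropOne-⋖ {i = i} u (ui≡1 , last) = ⋖-single c u i
  (λ e → case trans (sym ci≡0) (trans e ui≡1) of λ ())
  (subst (_≤ u ! i) (sym ci≡0) z≤n)
  (λ k k≢i → letter-elim (letter-at (dropOne-spec u i) k)
    (λ e → e)
    (λ ≢2 k<i → letter-one (nonzero-before-1 u (ℕₚ.<⇒≤ k<i) ui≡1) ≢2)
    (λ ≢2 k≮i → letter-zero (last k (Finₚ.≤∧≢⇒< (ℕₚ.≮⇒≥ k≮i) (k≢i ∘ sym))) ≢2))
  gap
  where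
  c = dropOne u i
  ci≡0 : c ! i ≡ 0F
  ci≡0 = dropOne≡0 u ui≡1
  gap : ∀ x → c ≤ᵗ x → x ≤ᵗ u → x ! i ≡ c ! i ⊎ x ! i ≡ u ! i
  gap x c≤x x≤u with x ! i | Pointwise.lookup x≤u i
  ... | 0F | _ = inj₁ (sym ci≡0)
  ... | 1F | _ = inj₂ (sym ui≡1)
  ... | 2F | p = case trans (sym ui≡1) (≡2 p) of λ ()

-- A cover raises some entry, and a raise either reaches 2 or goes from 0 to 1. The first kind leads
-- to a label `β i`, the second to a label `α i`.
⋖-witness : (c u : Triword n) → c ⋖ u →
  (∃[ i ] (c ! i ≢ 2F × u ! i ≡ 2F)) ⊎ (∃[ i ] (c ! i ≡ 0F × u ! i ≡ 1F))
⋖-witness {n} c u ((c≤u , c≢u) , _)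
  with i , ≢i ← Finₚ.¬∀⟶∃¬ n _ (λ i → u ! i Finₚ.≤? c ! i)
                  (λ h → c≢u (≤ᵗ-antisym c u c≤u (≼-ext h)))
  with c ! i in eᶜ | u ! i in eᵘ
... | _  | 0F = contradiction z≤n ≢i
... | 0F | 1F = inj₂ (i , eᶜ , eᵘ)
... | 1F | 1F = contradiction ℕₚ.≤-refl ≢i
... | 2F | 1F = contradiction (s≤s z≤n) ≢i
... | 0F | 2F = inj₁ (i , (λ e → case trans (sym eᶜ) e of λ ()) , eᵘ)
... | 1F | 2F = inj₁ (i , (λ e → case trans (sym eᶜ) e of λ ()) , eᵘ)
... | 2F | 2F = contradiction ℕₚ.≤-refl ≢i

-- A 2 that `c` lacks must come from the other joinand, and `β i` is the least triword with a 2 at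
-- `i`.
β-label : (c u : Triword n) → c ⋖ u → c ! i ≢ 2F → u ! i ≡ 2F → IsLabel c u (β i)
β-label {i = i} c u c⋖u c≢2 u≡2 =
  ⋖-join c u (β i) c⋖u (β≤ u u≡2)
    (λ p → c≢2 (two-mono (Pointwise.lookup p i) (β-at-self (first≢2 u u≡2)))) ,
  λ x e → β≤ x (case ∨-sel c x i of λ where
    (inj₁ s) → contradiction (trans (sym s) (trans (cong (_! i) e) u≡2)) c≢2
    (inj₂ s) → trans (sym s) (trans (cong (_! i) e) u≡2))

-- The other joinand must supply the 1 at `i`; by T3 it is then nonzero up to `i`, hence above
-- `α i`.
α-label : (c u : Triword n) → c ⋖ u → c ! i ≡ 0F → u ! i ≡ 1F → IsLabel c u (α i)
α-label {i = i} c u c⋖u c≡0 u≡1 =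
  ⋖-join c u (α i) c⋖u (α≤ u λ k k≤i → nonzero-before-1 u k≤i u≡1)
    (λ p → nonzero-mono (Pointwise.lookup p i) (α-at-self i) c≡0) ,
  λ x e → case ∨-sel c x i of λ where
    (inj₁ s) → case trans (sym c≡0) (trans (sym s) (trans (cong (_! i) e) u≡1)) of λ ()
    (inj₂ s) → α≤ x λ k k≤i →
      nonzero-before-1 x k≤i (trans (sym s) (trans (cong (_! i) e) u≡1))

label-unique : (c u l l′ : Triword n) → IsLabel c u l → IsLabel c u l′ → l ≡ l′
label-unique c u l l′ (e , h) (e′ , h′) = ≤ᵗ-antisym l l′ (h l′ e′) (h′ l e)

-- The nucleus

last-one : ∀ {n} (w : Word n) {k} → lookup w k ≡ 1F →
  ∃[ i ] (k ≤ i × lookup w i ≡ 1F × (∀ m → i < m → lookup w m ≢ 1F))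
last-one (x ∷ w) {suc k} e =
  let i , k≤i , eᵢ , last = last-one w e
  in suc i , s≤s k≤i , eᵢ , λ where (suc m) (s≤s i<m) → last m i<m
last-one (x ∷ w) {zero} e with Finₚ.any? (λ m → lookup w m Finₚ.≟ 1F)
... | yes (m , eₘ) =
  let i , _ , eᵢ , last = last-one w eₘ
  in suc i , z≤n , eᵢ , λ where (suc m) (s≤s i<m) → last m i<m
... | no ∄ = zero , z≤n , e , λ where (suc m) _ eₘ → ∄ (m , eₘ)

OneAfter : Triword n → Fin n → Set
OneAfter u k = ∃[ j ] (k < j × u ! j ≡ 1F)

-- The nucleus is 1...10...0 with ones exactly at the positions strictly before the last 1 of `u`;
-- it is the bottom element if `u` has no 1.
nucleus-spec : (u : Triword n) → Spec (λ _ → ⊥) (OneAfter u)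
nucleus-spec u = record
  { T?    = λ _ → no λ ()
  ; D?    = λ k → Finₚ.any? λ j → k Finₚ.<? j ×-dec u ! j Finₚ.≟ 1F
  ; first = λ ()
  ; down  = λ { i≤k (j , k<j , e) → j , ℕₚ.≤-<-trans i≤k k<j , e }
  }

nucleus : Triword n → Triword n
nucleus u = build (nucleus-spec u)

nucleus≤ : (u x : Triword n) →
  (∀ {k j : Fin n} → k < j → u ! j ≡ 1F → x ! k ≢ 0F) → nucleus u ≤ᵗ x
nucleus≤ u x h = ≼-ext λ k → ≤-letter
  (λ p → case letter≢0⁻ (letter-at (nucleus-spec u) k) p of λ { (inj₂ (j , k<j , e)) → h k<j e })
  (λ e → ⊥-elim (letter≡2⁻ (letter-at (nucleus-spec u) k) e))

-- If `c` had a 0 at `k`, the cover would force `c ∨ᵗ α k` to equal `u`. But at `j` neither joinand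
-- is 1: `c` by T3, and `α k` because it ends at `k`.
⋖-nonzero : (c u : Triword n) → c ⋖ u → k < j → u ! j ≡ 1F → c ! k ≢ 0F
⋖-nonzero {k = k} {j} c u c⋖u@((c≤u , _) , _) k<j uj≡1 ck≡0 =
  case ∨-sel c (α k) j of λ where
    (inj₁ s) → T3-recover c k<j ck≡0 (trans (sym s) join≡1)
    (inj₂ s) → ℕₚ.<⇒≱ k<j (α≢0⁻ k j λ e → case trans (sym e) (trans (sym s) join≡1) of λ ())
  where
  join≡1 : (c ∨ᵗ α k) ! j ≡ 1F
  join≡1 = trans
    (cong (_! j) (⋖-join c u (α k) c⋖u
      (α≤ u λ m m≤k → nonzero-before-1 u (ℕₚ.≤-trans m≤k (ℕₚ.<⇒≤ k<j)) uj≡1)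
      (λ p → nonzero-mono (Pointwise.lookup p k) (α-at-self k) ck≡0)))
    uj≡1

-- A lower bound has no 2, being below every `dropTwo u k`, and has a 0 at the last 1 of `u`, being
-- below the corresponding `dropOne`. By T3 its ones then lie before that position.
nucleus-isNucleus : (u : Triword n) → IsNucleus u (nucleus u)
nucleus-isNucleus u =
  ( nucleus≤ u u (λ k<j → nonzero-before-1 u (ℕₚ.<⇒≤ k<j))
  , (λ c c⋖u → nucleus≤ u c (⋖-nonzero c u c⋖u))) ,
  λ x (x≤u , x≤c) →
    let x≢2 : ∀ k → x ! k ≢ 2F
        x≢2 k e = dropTwo≢2 u k (two-mono
          (Pointwise.lookup (x≤c _ (dropTwo-⋖ u (two-mono (Pointwise.lookup x≤u k) e))) k) e)
    in ≼-ext λ k → ≤-letter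
      (λ p → letter≢0⁺ (letter-at (nucleus-spec u) k)
        (inj₂ (later-one x x≤u x≤c (letter-one p (x≢2 k)))))
      (λ e → contradiction e (x≢2 k))
  where
  later-one : ∀ x → x ≤ᵗ u → (∀ c → c ⋖ u → x ≤ᵗ c) →
              x ! k ≡ 1F → OneAfter u k
  later-one {k = k} x x≤u x≤c e
    -- The entry of `u` at `k` may be 2, so a 1 of `u` is taken from the first position instead.
    with _ , e₁ ← has-one u (λ i i≤k →
      nonzero-mono (Pointwise.lookup x≤u i) (nonzero-before-1 x i≤k e))
    with i , _ , eᵢ , last ← last-one (word u) e₁
    with xi≡0 ← ≡0 (subst (x ! i ≤_) (dropOne≡0 u eᵢ)
                      (Pointwise.lookup (x≤c _ (dropOne-⋖ u (eᵢ , last))) i))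
    with k Finₚ.<? i
  ... | yes k<i = i , k<i , eᵢ
  ... | no  k≮i = contradiction xi≡0 (nonzero-before-1 x (ℕₚ.≮⇒≥ k≮i) e)

-- Core label sets

-- Such positions run from the last 1 of `u` through the 2s directly after it. Without a 1, the
-- first entry of `u` is 0 and no position qualifies.
Block : Triword n → Fin n → Set
Block u j = (∀ k → k ≤ j → u ! k ≢ 0F) × (∀ k → j < k → u ! k ≢ 1F)

Ψ-elim : (u l : Triword n) → Ψ u l →
  (∃[ i ] (u ! i ≡ 2F × l ≡ β i)) ⊎ (∃[ j ] (Block u j × l ≡ α j))
Ψ-elim u l (ν , b , b′ , (_ , ν-max) , ν≤b , b⋖b′ , b′≤u , lab) with ⋖-witness b b′ b⋖b′
... | inj₁ (i , ≢2 , ≡2ᵢ) = inj₁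
  ( i , two-mono (Pointwise.lookup b′≤u i) ≡2ᵢ
  , label-unique b b′ l (β i) lab (β-label b b′ b⋖b′ ≢2 ≡2ᵢ))
... | inj₂ (j , b≡0 , b′≡1) = inj₂
  ( j
  , ( (λ k k≤j → nonzero-mono (Pointwise.lookup b′≤u k) (nonzero-before-1 b′ k≤j b′≡1))
    -- A 1 of `u` after `j` makes `nucleus u` nonzero at `j`. As `nucleus u` is below `ν` and `ν`
    -- below `b`, this contradicts the 0 of `b` at `j`.
    , (λ k j<k uk≡1 → nonzero-mono
        (Pointwise.lookup (≼-trans (ν-max (nucleus u) (proj₁ (nucleus-isNucleus u))) ν≤b) j)
        (letter≢0⁺ (letter-at (nucleus-spec u) j) (inj₂ (k , j<k , uk≡1)))
        b≡0))
  , label-unique b b′ l (α j) lab (α-label b b′ b⋖b′ b≡0 b′≡1))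

β∈Ψ : (u : Triword n) → u ! i ≡ 2F → Ψ u (β i)
β∈Ψ {i = i} u e =
  nucleus u , dropTwo u i , u , nucleus-isNucleus u ,
  proj₂ (proj₁ (nucleus-isNucleus u)) _ (dropTwo-⋖ u e) , dropTwo-⋖ u e , ≼-refl ,
  β-label (dropTwo u i) u (dropTwo-⋖ u e) (dropTwo≢2 u i) e

α-lastOne : (j : Fin n) → IsLastOne (α j) j
α-lastOne j = letter-one (α-at-self j) (α≢2 j j) ,
  λ k j<k e → ℕₚ.<⇒≱ j<k (α≢0⁻ j k λ e0 → case trans (sym e) e0 of λ ())

α∈Ψ : (u : Triword n) → Block u j → Ψ u (α j)
α∈Ψ {j = j} u (before , after) =
  -- The chosen cover ends at `α j` itself, which is below `u`. Its lower element is above the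
  -- nucleus because every 1 of `u` is at or before `j`.
  nucleus u , dropOne (α j) j , α j , nucleus-isNucleus u ,
  nucleus≤ u (dropOne (α j) j) (λ {k} {m} k<m e →
    letter≢0⁺ (letter-at (dropOne-spec (α j) j) k)
      (inj₂ (ℕₚ.<-≤-trans k<m (ℕₚ.≮⇒≥ λ j<m → after m j<m e)))) ,
  dropOne-⋖ (α j) (α-lastOne j) , α≤ u before ,
  α-label (dropOne (α j) j) (α j) (dropOne-⋖ (α j) (α-lastOne j))
    (dropOne≡0 (α j) (proj₁ (α-lastOne j))) (proj₁ (α-lastOne j))

β∈Ψ⁻ : (u : Triword n) → toℕ i ≢ 0 → Ψ u (β i) → u ! i ≡ 2F
β∈Ψ⁻ {i = i} u i≢0 p with Ψ-elim u (β i) p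
... | inj₁ (k , e , eq) =
  subst (λ k → u ! k ≡ 2F)
    (sym (β≡2⁻ k i (trans (cong (_! i) (sym eq)) (β-at-self i≢0)))) e
... | inj₂ (j , _ , eq) =
  contradiction (trans (cong (_! i) (sym eq)) (β-at-self i≢0)) (α≢2 j i)

α∈Ψ⁻ : (u : Triword n) → Ψ u (α j) → Block u j
α∈Ψ⁻ {j = j} u p with Ψ-elim u (α j) p
... | inj₁ (i , e , eq) = contradiction
  (trans (cong (_! i) eq) (β-at-self (first≢2 u e))) (α≢2 j i)
... | inj₂ (k , block , eq) = subst (Block u) (Finₚ.≤-antisym k≤j j≤k) block
  where
  k≤j : k ≤ j
  k≤j = α≢0⁻ j k (subst (λ w → w ! k ≢ 0F) (sym eq) (α-at-self k))
  j≤k : j ≤ k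
  j≤k = α≢0⁻ k j (subst (λ w → w ! j ≢ 0F) eq (α-at-self j))

-- The core label order in terms of twos and blocks

infix 4 _⊑ᵇ_

_⊑ᵇ_ : Triword n → Triword n → Set
u ⊑ᵇ v = (∀ i → u ! i ≡ 2F → v ! i ≡ 2F) × (∀ j → Block u j → Block v j)

⊑⇒⊑ᵇ : (u v : Triword n) → u ⊑ v → u ⊑ᵇ v
⊑⇒⊑ᵇ u v u⊑v =
  (λ i e → β∈Ψ⁻ v (first≢2 u e) (u⊑v {β i} (β∈Ψ u e))) ,
  (λ j b → α∈Ψ⁻ v (u⊑v {α j} (α∈Ψ u b)))

⊑ᵇ⇒⊑ : (u v : Triword n) → u ⊑ᵇ v → u ⊑ v
⊑ᵇ⇒⊑ u v (twos , blocks) {l} p with Ψ-elim u l p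
... | inj₁ (i , e , refl) = β∈Ψ v (twos i e)
... | inj₂ (j , b , refl) = α∈Ψ v (blocks j b)

-- Meets and joins for the core label order

-- Half-open: the smaller of two block positions may carry the last 1, while every later position up
-- to the larger one carries a 2.
Between : Fin n → Fin n → Fin n → Set
Between i j k = (i < k × k ≤ j) ⊎ (j < k × k ≤ i)

between-self : ¬ Between i i k
between-self (inj₁ (i<k , k≤i)) = ℕₚ.<⇒≱ i<k k≤i
between-self (inj₂ (i<k , k≤i)) = ℕₚ.<⇒≱ i<k k≤i

between? : (i j k : Fin n) → Dec (Between i j k)
between? i j k =
  (i Finₚ.<? k ×-dec k Finₚ.≤? j) ⊎-dec (j Finₚ.<? k ×-dec k Finₚ.≤? i)

between-first : Between i j k → toℕ k ≢ 0
between-first (inj₁ (i<k , _)) = ℕₚ.m<n⇒n≢0 i<k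
between-first (inj₂ (j<k , _)) = ℕₚ.m<n⇒n≢0 j<k

block? : (u : Triword n) → Decidable (Block u)
block? u j =
  (Finₚ.all? λ k → k Finₚ.≤? j →-dec ¬? (u ! k Finₚ.≟ 0F)) ×-dec
  (Finₚ.all? λ k → j Finₚ.<? k →-dec ¬? (u ! k Finₚ.≟ 1F))

block-between : (u : Triword n) → Block u i → Block u j → Between i j k → u ! k ≡ 2F
block-between u (_ , after) (before , _) (inj₁ (i<k , k≤j)) = letter-two (before _ k≤j) (after _ i<k)
block-between u (before , _) (_ , after) (inj₂ (j<k , k≤i)) = letter-two (before _ k≤i) (after _ j<k)

block-move : (u : Triword n) → Block u i → (∀ k → Between i j k → u ! k ≡ 2F) → Block u j
block-move {i = i} {j} u (before , after) twos =
  (λ k k≤j e → case k Finₚ.≤? i of λ where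
    (yes k≤i) → before k k≤i e
    (no k≰i)  → case trans (sym e) (twos k (inj₁ (ℕₚ.≰⇒> k≰i , k≤j))) of λ ()) ,
  (λ k j<k e → case k Finₚ.≤? i of λ where
    (yes k≤i) → case trans (sym e) (twos k (inj₂ (j<k , k≤i))) of λ ()
    (no k≰i)  → after k (ℕₚ.≰⇒> k≰i) e)

-- T becomes the set of twos and M a subset of the block.  Convexity puts all of M
-- in a single block, because two positions lie in the same block exactly when one of
-- them does and every entry between them is 2.
record Marked (T M : Pred (Fin n) 0ℓ) : Set where
  field
    T?     : Decidable T
    M?     : Decidable M
    first  : ∀ {i} → T i → toℕ i ≢ 0
    convex : ∀ {i j k} → M i → M j → Between i j k → T k

  spec : Spec T (λ k → ∃[ m ] (M m × k ≤ m))
  spec = record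
    { T?    = T?
    ; D?    = λ k → Finₚ.any? λ m → M? m ×-dec k Finₚ.≤? m
    ; first = first
    ; down  = λ { i≤j (m , Mm , j≤m) → m , Mm , Finₚ.≤-trans i≤j j≤m }
    }

  marked : Triword n
  marked = build spec

  twos⁺ : ∀ i → T i → marked ! i ≡ 2F
  twos⁺ i = letter≡2⁺ (letter-at spec i)

  twos⁻ : ∀ i → marked ! i ≡ 2F → T i
  twos⁻ i = letter≡2⁻ (letter-at spec i)

  -- A 1 after `j` would lie at or before some element of `M`, so `convex` would put it in `T` and
  -- make it a 2.
  block⁺ : ∀ j → M j → Block marked j
  block⁺ j Mj =
    (λ k k≤j → letter≢0⁺ (letter-at spec k) (inj₂ (j , Mj , k≤j))) ,
    (λ k j<k e → let ¬Tk , m , Mm , k≤m = letter≡1⁻ (letter-at spec k) e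
                 in ¬Tk (convex Mj Mm (inj₁ (j<k , k≤m))))

  block⁻ : ∀ j → Block marked j → ∃[ m ] (M m × (∀ k → Between m j k → T k))
  block⁻ j b =
    -- A block position forces a 1 in the word, and a 1 occurs only at or before an element of `M`;
    -- this supplies `m`.
    let i , e = has-one marked (proj₁ b)
        _ , m , Mm , _ = letter≡1⁻ (letter-at spec i) e
    in m , Mm , λ k between → twos⁻ k (block-between marked (block⁺ m Mm) b between)

-- Every block position of the constructed triword is linked by 2s to an element of `M`; these 2s
-- persist in `u`, so the position stays in the block of `u`.
marked-⊑ᵇ : (s : Marked T M) (u : Triword n) → (∀ i → T i → u ! i ≡ 2F) →
            (∀ j → M j → Block u j) → Marked.marked s ⊑ᵇ u
marked-⊑ᵇ s u twos blocks =
  (λ i e → twos i (Marked.twos⁻ s i e)) ,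
  (λ j b → let m , Mm , between = Marked.block⁻ s j b
           in block-move u (blocks m Mm) (λ k p → twos k (between k p)))

⊑ᵇ-marked : (s : Marked T M) (u : Triword n) → (∀ i → u ! i ≡ 2F → T i) →
            (∀ j → Block u j → M j) → u ⊑ᵇ Marked.marked s
⊑ᵇ-marked s u twos blocks =
  (λ i e → Marked.twos⁺ s i (twos i e)) , (λ j b → Marked.block⁺ s j (blocks j b))

-- Join and meet of two triwords

module _ (u v : Triword n) where

  EitherBlock BothBlocks : Pred (Fin n) 0ℓ
  EitherBlock j = Block u j ⊎ Block v j
  BothBlocks  j = Block u j × Block v j

  EitherTwo BothTwo : Pred (Fin n) 0ℓ
  EitherTwo k = (u ! k ≡ 2F ⊎ v ! k ≡ 2F) ⊎
    (∃[ i ] ∃[ j ] (EitherBlock i × EitherBlock j × Between i j k))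
  BothTwo   k = u ! k ≡ 2F × v ! k ≡ 2F

  eitherBlock? : Decidable EitherBlock
  eitherBlock? j = block? u j ⊎-dec block? v j

  join-marked : Marked EitherTwo EitherBlock
  join-marked = record
    { T?     = λ k → (u ! k Finₚ.≟ 2F ⊎-dec v ! k Finₚ.≟ 2F) ⊎-dec
                 (Finₚ.any? λ i → Finₚ.any? λ j →
                   eitherBlock? i ×-dec eitherBlock? j ×-dec between? i j k)
    ; M?     = eitherBlock?
    ; first  = λ where
        (inj₁ (inj₁ e)) → first≢2 u e
        (inj₁ (inj₂ e)) → first≢2 v e
        (inj₂ (_ , _ , _ , _ , between)) → between-first between
    ; convex = λ bᵢ bⱼ between → inj₂ (_ , _ , bᵢ , bⱼ , between)
    }

  -- Convexity passes to the intersection: entries between two common block positions are 2 in both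
  -- words.
  meet-marked : Marked BothTwo BothBlocks
  meet-marked = record
    { T?     = λ k → u ! k Finₚ.≟ 2F ×-dec v ! k Finₚ.≟ 2F
    ; M?     = λ j → block? u j ×-dec block? v j
    ; first  = λ (e , _) → first≢2 u e
    ; convex = λ (uᵢ , vᵢ) (uⱼ , vⱼ) between →
        block-between u uᵢ uⱼ between , block-between v vᵢ vⱼ between
    }

  join meet : Triword n
  join = Marked.marked join-marked
  meet = Marked.marked meet-marked

  join-ub₁ : u ⊑ᵇ join
  join-ub₁ = ⊑ᵇ-marked join-marked u (λ _ → inj₁ ∘ inj₁) (λ _ → inj₁)

  join-ub₂ : v ⊑ᵇ join
  join-ub₂ = ⊑ᵇ-marked join-marked v (λ _ → inj₁ ∘ inj₂) (λ _ → inj₂)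

  join-lub : ∀ x → u ⊑ᵇ x → v ⊑ᵇ x → join ⊑ᵇ x
  join-lub x (twosᵘ , blocksᵘ) (twosᵛ , blocksᵛ) = marked-⊑ᵇ join-marked x
    (λ where
      k (inj₁ (inj₁ e)) → twosᵘ k e
      k (inj₁ (inj₂ e)) → twosᵛ k e
      -- An upper bound has `i` and `j` in its single block, which forces the added 2s.
      k (inj₂ (i , j , bᵢ , bⱼ , between)) → block-between x (blocks i bᵢ) (blocks j bⱼ) between)
    blocks
    where
    blocks : ∀ j → EitherBlock j → Block x j
    blocks j (inj₁ b) = blocksᵘ j b
    blocks j (inj₂ b) = blocksᵛ j b

  meet-lb₁ : meet ⊑ᵇ u
  meet-lb₁ = marked-⊑ᵇ meet-marked u (λ _ → proj₁) (λ _ → proj₁)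

  meet-lb₂ : meet ⊑ᵇ v
  meet-lb₂ = marked-⊑ᵇ meet-marked v (λ _ → proj₂) (λ _ → proj₂)

  meet-glb : ∀ x → x ⊑ᵇ u → x ⊑ᵇ v → x ⊑ᵇ meet
  meet-glb x (twosᵘ , blocksᵘ) (twosᵛ , blocksᵛ) = ⊑ᵇ-marked meet-marked x
    (λ k e → twosᵘ k e , twosᵛ k e) (λ j b → blocksᵘ j b , blocksᵛ j b)

-- Antisymmetry and the lattice structure

one-block : (u : Triword n) → u ! k ≡ 1F → ∃[ j ] (k ≤ j × Block u j)
one-block u e =
  let j , k≤j , eⱼ , last = last-one (word u) e
  in j , k≤j , (λ i i≤j → nonzero-before-1 u i≤j eⱼ) , last

-- A 1 of `u` is at or before its last 1, a block position of `u` and hence of `v`, so `v` is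
-- nonzero there. Antisymmetry is thus inherited from the componentwise order.
⊑ᵇ⇒≤ : (u v : Triword n) → u ⊑ᵇ v → u ≤ᵗ v
⊑ᵇ⇒≤ u v (twos , blocks) = ≼-ext λ k → ≤-letter (nonzero k) (twos k)
  where
  nonzero : ∀ k → u ! k ≢ 0F → v ! k ≢ 0F
  nonzero k p e with u ! k in eᵘ
  ... | 0F = p refl
  ... | 1F = let j , k≤j , b = one-block u eᵘ in proj₁ (blocks j b) k k≤j e
  ... | 2F = case trans (sym e) (twos k eᵘ) of λ ()

⊑-antisym : (u v : Triword n) → u ⊑ v → v ⊑ u → u ≡ v
⊑-antisym u v p q = ≤ᵗ-antisym u v
  (⊑ᵇ⇒≤ u v (⊑⇒⊑ᵇ u v λ {l} → p {l}))
  (⊑ᵇ⇒≤ v u (⊑⇒⊑ᵇ v u λ {l} → q {l}))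

theorem5p7 : (n : ℕ) → n > 0 → IsLatticeOrder (_≡_ {A = Triword n}) (CoreLabel._⊑_ (Hoch n))
theorem5p7 n _ = join , meet , record
  { isPartialOrder = record
    { isPreorder = record
      { isEquivalence = isEquivalence
      ; reflexive     = λ { refl p → p }
      ; trans         = λ p q {l} r → q {l} (p {l} r)
      }
    ; antisym = λ {u} {v} p q → ⊑-antisym u v (λ {l} → p {l}) (λ {l} → q {l})
    }
  ; supremum = λ u v →
      (λ {l} → ⊑ᵇ⇒⊑ u (join u v) (join-ub₁ u v) {l}) ,
      (λ {l} → ⊑ᵇ⇒⊑ v (join u v) (join-ub₂ u v) {l}) ,
      λ x p q {l} → ⊑ᵇ⇒⊑ (join u v) x
        (join-lub u v x (⊑⇒⊑ᵇ u x λ {l} → p {l}) (⊑⇒⊑ᵇ v x λ {l} → q {l})) {l}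
  ; infimum = λ u v →
      (λ {l} → ⊑ᵇ⇒⊑ (meet u v) u (meet-lb₁ u v) {l}) ,
      (λ {l} → ⊑ᵇ⇒⊑ (meet u v) v (meet-lb₂ u v) {l}) ,
      λ x p q {l} → ⊑ᵇ⇒⊑ x (meet u v)
        (meet-glb u v x (⊑⇒⊑ᵇ x u λ {l} → p {l}) (⊑⇒⊑ᵇ x v λ {l} → q {l})) {l}
  }
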